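{- The model checking problem for $\mathrm{EG}$ formulae over gap-order constraint systems is undecidable. That is, there is no algorithm which, given a GCS $\mathcal{G}=(\mathit{Var},\mathit{Const},\mathit{Act},\Delta,\lambda)$, a valuation $\nu:\mathit{Var}\to\mathbb{Z}$ and an $\mathrm{EG}$ formula $\psi$, decides whether $\nu\models\psi$ (i.e.\ whether $\nu\in[\![\psi]\!]$).
   Context: Fix finite sets $\mathit{Var}$ of variables (ranging over $\mathbb{Z}$) and $\mathit{Const}\subseteq\mathbb{Z}$ of constants. A valuation is a map $\nu:\mathit{Var}\to\mathbb{Z}$, extended by $\nu(c)=c$ for constants $c$; $\mathit{Val}$ is the set of valuations. A gap clause is an inequation $x-y\ge k$ with $x,y\in\mathit{Var}\cup\mathit{Const}$ and $k\in\mathbb{Z}$; it is positive if $k\in\mathbb{N}$. $\nu$ satisfies it iff $\nu(x)-\nu(y)\ge k$. A (positive) gap constraint is a finite conjunction of (positive) gap clauses. Let $\mathit{Var}'=\{x'\mid x\in\mathit{Var}\}$ be primed copies; a transitional gap constraint is a gap constraint over variables $\mathit{Var}\cup\mathit{Var}'$. For valuations $\nu,\nu'$, let $\nu\oplus\nu'$ map $x\mapsto\nu(x)$ and $x'\mapsto\nu'(x)$. A gap-order constraint system (GCS) is a tuple $\mathcal{G}=(\mathit{Var},\mathit{Const},\mathit{Act},\Delta,\lambda)$ where $\mathit{Act}$ is a finite set of actions, $\Delta$ a finite set of positive transitional gap constraints and $\lambda:\Delta\to\mathit{Act}$. Its semantics is the labeled transition system with states $\mathit{Val}$ and $\nu\xrightarrow{a}\nu'$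 iff $\nu\oplus\nu'$ satisfies some $C\in\Delta$ with $\lambda(C)=a$. $\mathrm{EG}$ formulae are given by $\psi::=C\mid \mathit{true}\mid\neg\psi\mid\psi\wedge\psi\mid\langle a\rangle\psi\mid \mathrm{EG}\,\psi$, where $C$ ranges over gap clauses and $a\in\mathit{Act}$. Semantics: $[\![C]\!]$ is the set of valuations satisfying $C$; $[\![\mathit{true}]\!]=\mathit{Val}$; negation and conjunction are complement and intersection; $[\![\langle a\rangle\psi]\!]=\{\nu\mid\exists\nu'\in[\![\psi]\!].\ \nu\xrightarrow{a}\nu'\}$; $[\![\mathrm{EG}\,\psi]\!]$ is the set of $\nu_0$ from which there is an infinite path $\nu_0\xrightarrow{a_0}\nu_1\xrightarrow{a_1}\cdots$ with all $\nu_i\in[\![\psi]\!]$. -}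

module Defs where

open import Data.Nat using (ℕ; zero; suc)
open import Data.Integer using (ℤ; +_; _-_; _≤_)
open import Data.Fin using (Fin)
open import Data.Sum using (_⊎_; inj₁; inj₂)
open import Data.Product using (Σ; _×_; _,_)
open import Data.List using (List)
open import Data.List.Relation.Unary.All using (All)
open import Data.Maybe using (Maybe; just; nothing)
open import Data.Bool using (Bool; true; false)
open import Data.Unit using (⊤)
open import Data.Empty using (⊥)
open import Relation.Nullary using (¬_)
open import Relation.Binary.PropositionalEquality using (_≡_)
open import Function.Bundles using (_⇔_)

data Term (V : Set) : Set where
  var : V → Term V
  cst : ℤ → Term V

eval : {V : Set} → (V → ℤ) → Term V → ℤ
eval ν (var x) = ν x
eval ν (cst c) = c

record GapClause (V : Set) : Set where
  constructor gap
  field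
    lhs rhs : Term V
    bound   : ℤ

record PosGapClause (V : Set) : Set where
  constructor pgap
  field
    lhs rhs : Term V
    bound   : ℕ

SatClause : {V : Set} → (V → ℤ) → GapClause V → Set
SatClause ν (gap x y k) = k ≤ eval ν x - eval ν y

SatPosClause : {V : Set} → (V → ℤ) → PosGapClause V → Set
SatPosClause ν (pgap x y k) = + k ≤ eval ν x - eval ν y

Val : ℕ → Set
Val n = Fin n → ℤ

-- Transitional variables: inj₁ x is x, inj₂ x is x'.
TVar : ℕ → Set
TVar n = Fin n ⊎ Fin n

_⊕_ : {n : ℕ} → Val n → Val n → (TVar n → ℤ)
(ν ⊕ ν') (inj₁ x) = ν x
(ν ⊕ ν') (inj₂ x) = ν' x

PosTransConstraint : ℕ → Set
PosTransConstraint n = List (PosGapClause (TVar n))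

-- A GCS with Var = Fin nVar, Act = Fin nAct, Δ indexed by Fin nΔ,
-- labelling λ = label.
record GCS : Set where
  field
    nVar  : ℕ
    nAct  : ℕ
    nΔ    : ℕ
    Δ     : Fin nΔ → PosTransConstraint nVar
    label : Fin nΔ → Fin nAct

open GCS public

Step : (G : GCS) → Fin (nAct G) → Val (nVar G) → Val (nVar G) → Set
Step G a ν ν' =
  Σ (Fin (nΔ G)) λ C → (label G C ≡ a) × All (SatPosClause (ν ⊕ ν')) (Δ G C)

data Form (n m : ℕ) : Set where
  clause : GapClause (Fin n) → Form n m
  tt     : Form n m
  neg    : Form n m → Form n m
  and    : Form n m → Form n m → Form n m
  dia    : Fin m → Form n m → Form n m
  EG     : Form n m → Form n m

⟦_⟧ : {G : GCS} → Form (nVar G) (nAct G) → Val (nVar G) → Set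
⟦ clause C ⟧ ν = SatClause ν C
⟦ tt ⟧ ν = ⊤
⟦_⟧ {G} (neg ψ) ν = ¬ (⟦_⟧ {G} ψ ν)
⟦_⟧ {G} (and ψ φ) ν = ⟦_⟧ {G} ψ ν × ⟦_⟧ {G} φ ν
⟦_⟧ {G} (dia a ψ) ν = Σ (Val (nVar G)) λ ν' → Step G a ν ν' × ⟦_⟧ {G} ψ ν'
⟦_⟧ {G} (EG ψ) ν =
  Σ (ℕ → Val (nVar G)) λ path →
  Σ (ℕ → Fin (nAct G)) λ acts →
    (∀ x → path 0 x ≡ ν x)
    × (∀ i → Step G (acts i) (path i) (path (suc i)))
    × (∀ i → ⟦_⟧ {G} ψ (path i))

record MCInstance : Set where
  constructor mc
  field
    sys  : GCS
    val  : Val (nVar sys)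
    form : Form (nVar sys) (nAct sys)

ModelCheck : MCInstance → Set
ModelCheck (mc G ν ψ) = ⟦_⟧ {G} ψ ν

-- Reference undecidable problem: halting of two-counter Minsky machines
-- started in (pc = 0, c₀ = 0, c₁ = 0).

data Instr : Set where
  inc : Fin 2 → ℕ → Instr          -- increment counter, goto j
  jzdec : Fin 2 → ℕ → ℕ → Instr    -- if counter = 0 goto k else decrement, goto j

Program : Set
Program = List Instr

record Config : Set where
  constructor cfg
  field
    pc : ℕ
    c₀ c₁ : ℕ

lookupI : Program → ℕ → Maybe Instr
lookupI List.[] _ = nothing
lookupI (i List.∷ _) zero = just i
lookupI (_ List.∷ is) (suc k) = lookupI is k

getC : Fin 2 → Config → ℕ
getC Fin.zero (cfg _ a _) = a
getC (Fin.suc _) (cfg _ _ b) = b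

setC : Fin 2 → ℕ → Config → Config
setC Fin.zero v (cfg p _ b) = cfg p v b
setC (Fin.suc _) v (cfg p a _) = cfg p a v

setPC : ℕ → Config → Config
setPC p (cfg _ a b) = cfg p a b

-- One step; a halted configuration (pc outside the program) is fixed.
stepM : Program → Config → Config
stepM P c with lookupI P (Config.pc c)
... | nothing = c
... | just (inc r j) = setPC j (setC r (suc (getC r c)) c)
... | just (jzdec r j k) with getC r c
...   | zero = setPC k c
...   | suc v = setPC j (setC r v c)

run : Program → ℕ → Config
run P zero = cfg 0 0 0
run P (suc t) = stepM P (run P t)

isHalted : Program → Config → Bool
isHalted P c with lookupI P (Config.pc c)
... | nothing = true
... | just _ = false

Halts : Program → Set
Halts P = Σ ℕ λ t → isHalted P (run P t) ≡ true

-- Synthetic many-one reducibility: a (computable, since it is an Agda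
-- function) map f with  P x ⇔ Q (f x).

_⪯_ : {A B : Set} → (A → Set) → (B → Set) → Set
_⪯_ {A} {B} P Q = Σ (A → B) λ f → ∀ x → P x ⇔ Q (f x)

module Submission where

-- Undecidability of EG model checking over gap-order constraint systems,
-- by a computable reduction from non-halting of two-counter machines.
--
-- The GCS has six variables: the program counter and both counters of a
-- "previous" configuration, and the same for a "next" configuration.  Its
-- single transition copies next into previous and leaves next arbitrary.
-- The quantifier-free formula  stepF P  says that the previous
-- configuration is not halted and that next is its successor under P.
-- Hence a path along which  stepF P  holds everywhere is forced to
-- enumerate the run of P (first state given, later states forced by the
-- copy transition), and such a path exists iff the run never halts.

open import Defs
open import Data.Sum using (_⊎_; inj₁; inj₂)
open import Relation.Nullary using (¬_; Dec)

open import Data.Nat as ℕ using (ℕ; zero; suc; _<_; s≤s; z≤n)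
import Data.Nat.Properties as ℕP
open import Data.Integer as ℤ using (ℤ; +_; -[1+_]; _-_; -_; +≤+)
import Data.Integer.Properties as ℤP
open import Data.Integer.Tactic.RingSolver using (solve-∀)
open import Data.Fin using (Fin) renaming (zero to fz; suc to fs)
open import Data.Product using (_×_; _,_; proj₁; proj₂)
open import Data.Product.Function.NonDependent.Propositional using (_×-⇔_)
open import Data.List using ([]; _∷_; _++_; length)
open import Data.List.Relation.Unary.All using ([]; _∷_)
open import Data.Maybe using (just; nothing)
open import Data.Bool using (true; false)
open import Data.Bool.Properties using (¬-not)
open import Data.Unit using (tt)
open import Data.Empty using (⊥-elim)
open import Relation.Nullary.Decidable using (decidable-stable; ¬?; _×-dec_)
open import Relation.Binary.PropositionalEquality
open import Function.Bundles using (_⇔_; mk⇔; Equivalence)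
open import Function.Properties.Equivalence using () renaming (refl to ⇔-refl; trans to ⇔-trans)

open Equivalence using (to; from)

gap⇔ : ∀ {k x y} → (k ℤ.≤ x - y) ⇔ (k ℤ.+ y ℤ.≤ x)
gap⇔ {k} {x} {y} = mk⇔
  (λ h → subst (k ℤ.+ y ℤ.≤_) (cancel x y) (ℤP.+-monoˡ-≤ y h))
  (λ h → subst (ℤ._≤ x - y) (cancel′ k y) (ℤP.+-monoˡ-≤ (- y) h))
  where
  cancel : ∀ x y → (x - y) ℤ.+ y ≡ x
  cancel = solve-∀
  cancel′ : ∀ k y → (k ℤ.+ y) - y ≡ k
  cancel′ = solve-∀

gap-one⇔ : ∀ {m n} → (+ 1 ℤ.≤ + m - + n) ⇔ (n < m)
gap-one⇔ {m} {n} = ⇔-trans (gap⇔ {+ 1} {+ m} {+ n}) (mk⇔ ℤP.drop‿+≤+ +≤+)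

gap-pair⇔ : ∀ {k x y} → (k ℤ.≤ x - y × - k ℤ.≤ y - x) ⇔ (x ≡ k ℤ.+ y)
gap-pair⇔ {k} {x} {y} = mk⇔
  (λ (lo , hi) → trans (sym (add-back x y)) (cong (ℤ._+ y) (ℤP.≤-antisym (upper hi) lo)))
  (λ { refl → ℤP.≤-reflexive (sym (ahead k y)) , ℤP.≤-reflexive (sym (behind k y)) })
  where
  add-back : ∀ x y → (x - y) ℤ.+ y ≡ x
  add-back = solve-∀
  ahead : ∀ k y → (k ℤ.+ y) - y ≡ k
  ahead = solve-∀
  behind : ∀ k y → y - (k ℤ.+ y) ≡ - k
  behind = solve-∀
  swap : ∀ x y → y - x ≡ - (x - y)
  swap = solve-∀
  upper : - k ℤ.≤ y - x → x - y ℤ.≤ k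
  upper h = ℤP.neg-cancel-≤ (subst (- k ℤ.≤_) (swap x y) h)

retarget : ∀ {x a n m} s → a ≡ + n → + m ≡ s ℤ.+ + n → (x ≡ s ℤ.+ a) ⇔ (x ≡ + m)
retarget s e d = mk⇔ (λ h → trans h (trans (cong (λ t → s ℤ.+ t) e) (sym d)))
                     (λ h → trans h (trans d (cong (λ t → s ℤ.+ t) (sym e))))

module Connectives (G : GCS) where

  Fm : Set
  Fm = Form (nVar G) (nAct G)

  V : Set
  V = Term (Fin (nVar G))

  sat : Fm → Val (nVar G) → Set
  sat = ⟦_⟧ {G}

  equal : V → ℤ → V → Fm
  equal x k y = and (clause (gap x y k)) (clause (gap y x (- k)))

  equal-sat : ∀ {ν} x k y → sat (equal x k y) ν ⇔ (eval ν x ≡ k ℤ.+ eval ν y)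
  equal-sat x k y = gap-pair⇔

  gap-one-at : ∀ {ν m n} t u → eval ν t ≡ + m → eval ν u ≡ + n →
               sat (clause (gap t u (+ 1))) ν ⇔ (n < m)
  gap-one-at t u et eu = subst₂ (λ a b → (+ 1 ℤ.≤ a - b) ⇔ _) (sym et) (sym eu) gap-one⇔

  infixr 4 _⊃_
  _⊃_ : Fm → Fm → Fm
  φ ⊃ ψ = neg (and φ (neg ψ))

  cases : Fm → Fm → Fm → Fm
  cases φ ψ χ = and (φ ⊃ ψ) (neg φ ⊃ χ)

  data QF : Fm → Set where
    atom : ∀ C → QF (clause C)
    not  : ∀ {φ} → QF φ → QF (neg φ)
    both : ∀ {φ ψ} → QF φ → QF ψ → QF (and φ ψ)

  -- Quantifier-free formulas are decidable, hence satisfy double negation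
  -- elimination; this is what lets  _⊃_  be used as a classical implication.
  qf-dec : ∀ {φ} → QF φ → ∀ ν → Dec (sat φ ν)
  qf-dec (atom (gap x y k)) ν = k ℤP.≤? eval ν x - eval ν y
  qf-dec (not q)            ν = ¬? (qf-dec q ν)
  qf-dec (both q r)         ν = qf-dec q ν ×-dec qf-dec r ν

  ⊃-fires : ∀ {φ ψ ν} → QF ψ → sat φ ν → sat (φ ⊃ ψ) ν ⇔ sat ψ ν
  ⊃-fires {ν = ν} q h = mk⇔ (λ i → decidable-stable (qf-dec q ν) (λ ¬ψ → i (h , ¬ψ)))
                            (λ s (_ , ¬ψ) → ¬ψ s)

  ⊃-vacuous : ∀ {φ ψ ν} → ¬ sat φ ν → sat (φ ⊃ ψ) ν
  ⊃-vacuous ¬φ (φ , _) = ¬φ φ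

  ⊃-qf : ∀ {φ ψ} → QF φ → QF ψ → QF (φ ⊃ ψ)
  ⊃-qf q r = not (both q (not r))

  cases-qf : ∀ {φ ψ χ} → QF φ → QF ψ → QF χ → QF (cases φ ψ χ)
  cases-qf q r s = both (⊃-qf q r) (⊃-qf (not q) s)

  cases-then : ∀ {φ ψ χ ν} → QF ψ → sat φ ν → sat (cases φ ψ χ) ν ⇔ sat ψ ν
  cases-then q h = mk⇔ (λ (i , _) → to (⊃-fires q h) i)
                       (λ s → from (⊃-fires q h) s , ⊃-vacuous (λ ¬φ → ¬φ h))

  cases-else : ∀ {φ ψ χ ν} → QF χ → ¬ sat φ ν → sat (cases φ ψ χ) ν ⇔ sat χ ν
  cases-else q ¬h = mk⇔ (λ (_ , i) → to (⊃-fires q ¬h) i)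
                        (λ s → ⊃-vacuous ¬h , from (⊃-fires q ¬h) s)

prevPc prevC₀ prevC₁ nextPc nextC₀ nextC₁ : Fin 6
prevPc = fz
prevC₀ = fs fz
prevC₁ = fs (fs fz)
nextPc = fs (fs (fs fz))
nextC₀ = fs (fs (fs (fs fz)))
nextC₁ = fs (fs (fs (fs (fs fz))))

prevC : Fin 2 → Fin 6
prevC fz     = prevC₀
prevC (fs _) = prevC₁

copyInto : Fin 6 → Fin 6 → PosTransConstraint 6
copyInto x y = pgap (var (inj₂ y)) (var (inj₁ x)) 0 ∷ pgap (var (inj₁ x)) (var (inj₂ y)) 0 ∷ []

copySys : GCS
copySys = record
  { nVar = 6 ; nAct = 1 ; nΔ = 1 ; label = λ _ → fz
  ; Δ = λ _ → copyInto nextPc prevPc ++ copyInto nextC₀ prevC₀ ++ copyInto nextC₁ prevC₁ }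

open Connectives copySys

zero-gaps⇔ : ∀ {a b} → (+ 0 ℤ.≤ a - b × + 0 ℤ.≤ b - a) ⇔ (a ≡ b)
zero-gaps⇔ {a} {b} = ⇔-trans gap-pair⇔ (mk⇔ (λ e → trans e (ℤP.+-identityˡ b))
                                            (λ e → trans e (sym (ℤP.+-identityˡ b))))

copy-step⇔ : ∀ {a ν ν'} → Step copySys a ν ν' ⇔
               (ν' prevPc ≡ ν nextPc × ν' prevC₀ ≡ ν nextC₀ × ν' prevC₁ ≡ ν nextC₁)
copy-step⇔ {fz} = mk⇔
  (λ { (_ , _ , (p₁ ∷ p₂ ∷ a₁ ∷ a₂ ∷ b₁ ∷ b₂ ∷ [])) →
      to zero-gaps⇔ (p₁ , p₂) , to zero-gaps⇔ (a₁ , a₂) , to zero-gaps⇔ (b₁ , b₂) })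
  (λ (p , a , b) → let (p₁ , p₂) = from zero-gaps⇔ p
                       (a₁ , a₂) = from zero-gaps⇔ a
                       (b₁ , b₂) = from zero-gaps⇔ b
                   in fz , refl , (p₁ ∷ p₂ ∷ a₁ ∷ a₂ ∷ b₁ ∷ b₂ ∷ []))

record Holds (p x y : Fin 6) (c : Config) (ν : Val 6) : Set where
  constructor holds
  field
    pc-is : ν p ≡ + Config.pc c
    c₀-is : ν x ≡ + Config.c₀ c
    c₁-is : ν y ≡ + Config.c₁ c

holds⇔ : ∀ {p x y c ν} →
         (ν p ≡ + Config.pc c × ν x ≡ + Config.c₀ c × ν y ≡ + Config.c₁ c) ⇔ Holds p x y c ν
holds⇔ = mk⇔ (λ (a , b , c) → holds a b c) (λ (holds a b c) → a , b , c)

Prev Next : Config → Val 6 → Set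
Prev = Holds prevPc prevC₀ prevC₁
Next = Holds nextPc nextC₀ nextC₁

prev-counter : ∀ {c ν} → Prev c ν → ∀ r → ν (prevC r) ≡ + getC r c
prev-counter p fz     = Holds.c₀-is p
prev-counter p (fs _) = Holds.c₁-is p

encode : Config → Config → Val 6
encode c d fz                          = + Config.pc c
encode c d (fs fz)                     = + Config.c₀ c
encode c d (fs (fs fz))                = + Config.c₁ c
encode c d (fs (fs (fs fz)))           = + Config.pc d
encode c d (fs (fs (fs (fs fz))))      = + Config.c₀ d
encode c d (fs (fs (fs (fs (fs fz))))) = + Config.c₁ d

exec : Instr → Config → Config
exec (inc r j) c = setPC j (setC r (suc (getC r c)) c)
exec (jzdec r j k) c with getC r c
... | zero  = setPC k c
... | suc v = setPC j (setC r v c)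

lookup-in-range : ∀ P p {ins} → lookupI P p ≡ just ins → p < length P
lookup-in-range (_ ∷ P) zero    e = s≤s z≤n
lookup-in-range (_ ∷ P) (suc p) e = s≤s (lookup-in-range P p e)

in-range-lookup : ∀ P p → p < length P → lookupI P p ≢ nothing
in-range-lookup (_ ∷ P) zero    lt      ()
in-range-lookup (_ ∷ P) (suc p) (s≤s lt) = in-range-lookup P p lt

true≢false : true ≢ false
true≢false ()

running : ∀ P c {ins} → lookupI P (Config.pc c) ≡ just ins → isHalted P c ≡ false
running P c e rewrite e = refl

halted : ∀ P c → lookupI P (Config.pc c) ≡ nothing → isHalted P c ≡ true
halted P c e rewrite e = refl

stepM-exec : ∀ P c {ins} → lookupI P (Config.pc c) ≡ just ins → stepM P c ≡ exec ins c
stepM-exec P c {inc r j}       e rewrite e = refl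
stepM-exec P c {jzdec r j k}   e rewrite e with getC r c
... | zero  = refl
... | suc v = refl

only : Fin 2 → ℤ → Fin 2 → ℤ
only fz     d fz     = d
only (fs _) d (fs _) = d
only fz     d (fs _) = + 0
only (fs _) d fz     = + 0

setC-shift : ∀ r d v c → + v ≡ d ℤ.+ + getC r c →
             ∀ r' → + getC r' (setC r v c) ≡ only r d r' ℤ.+ + getC r' c
setC-shift fz     d v c e fz     = e
setC-shift (fs _) d v c e (fs _) = e
setC-shift fz     d v c e (fs _) = refl
setC-shift (fs _) d v c e fz     = refl

moveTo : ℕ → (Fin 2 → ℤ) → Fm
moveTo j shift = and (equal (var nextPc) (+ 0) (cst (+ j)))
                (and (equal (var nextC₀) (shift fz) (var prevC₀))
                     (equal (var nextC₁) (shift (fs fz)) (var prevC₁)))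

moveTo-qf : ∀ j shift → QF (moveTo j shift)
moveTo-qf j shift = both (both (atom _) (atom _))
                         (both (both (atom _) (atom _)) (both (atom _) (atom _)))

positive : Fin 2 → Fm
positive r = clause (gap (var (prevC r)) (cst (+ 0)) (+ 1))

instr : Instr → Fm
instr (inc r j)     = moveTo j (only r (+ 1))
instr (jzdec r j k) = cases (positive r) (moveTo j (only r -[1+ 0 ])) (moveTo k (λ _ → + 0))

instr-qf : ∀ ins → QF (instr ins)
instr-qf (inc r j)     = moveTo-qf j (only r (+ 1))
instr-qf (jzdec r j k) = cases-qf (atom _) (moveTo-qf j (only r -[1+ 0 ])) (moveTo-qf k (λ _ → + 0))

moveTo-correct : ∀ {c c' ν} j shift → Prev c ν →
                 (∀ r → + getC r c' ≡ shift r ℤ.+ + getC r c) →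
                 sat (moveTo j shift) ν ⇔ Next (setPC j c') ν
moveTo-correct {ν = ν} j shift (holds _ e₀ e₁) d =
  ⇔-trans (equal-sat {ν} (var nextPc) (+ 0) (cst (+ j))
             ×-⇔ equal-sat {ν} (var nextC₀) (shift fz) (var prevC₀)
             ×-⇔ equal-sat {ν} (var nextC₁) (shift (fs fz)) (var prevC₁))
  (⇔-trans (⇔-refl ×-⇔ retarget (shift fz) e₀ (d fz) ×-⇔ retarget (shift (fs fz)) e₁ (d (fs fz)))
           holds⇔)

positive⇔ : ∀ {c ν} r → Prev c ν → sat (positive r) ν ⇔ (0 < getC r c)
positive⇔ {ν = ν} r p = gap-one-at {ν} (var (prevC r)) (cst (+ 0)) (prev-counter p r) refl

instr-correct : ∀ {c ν} ins → Prev c ν → sat (instr ins) ν ⇔ Next (exec ins c) ν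
instr-correct {c} (inc r j) p =
  moveTo-correct j (only r (+ 1)) p (setC-shift r (+ 1) (suc (getC r c)) c refl)
instr-correct {c} {ν} (jzdec r j k) p with getC r c in eq
... | zero  = ⇔-trans (cases-else {positive r} {decrement} {ν = ν} (moveTo-qf k (λ _ → + 0)) is-zero)
                      (moveTo-correct k (λ _ → + 0) p (λ _ → refl))
  where
  decrement : Fm
  decrement = moveTo j (only r -[1+ 0 ])
  is-zero : ¬ sat (positive r) ν
  is-zero h = ℕP.<-irrefl (sym eq) (to (positive⇔ r p) h)
... | suc v = ⇔-trans (cases-then {positive r} {χ = moveTo k (λ _ → + 0)} {ν = ν}
                                  (moveTo-qf j (only r -[1+ 0 ])) is-positive)
                      (moveTo-correct j (only r -[1+ 0 ]) p (setC-shift r -[1+ 0 ] v c one-less))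
  where
  is-positive : sat (positive r) ν
  is-positive = from (positive⇔ r p) (subst (0 <_) (sym eq) (s≤s z≤n))
  one-less : + v ≡ -[1+ 0 ] ℤ.+ + getC r c
  one-less = cong (λ n → -[1+ 0 ] ℤ.+ + n) (sym eq)

at : ℕ → Fm
at i = equal (var prevPc) (+ 0) (cst (+ i))

at⇔ : ∀ {c ν} i → Prev c ν → sat (at i) ν ⇔ (Config.pc c ≡ i)
at⇔ {ν = ν} i p = ⇔-trans (equal-sat {ν} (var prevPc) (+ 0) (cst (+ i)))
  (mk⇔ (λ e → ℤP.+-injective (trans (sym (Holds.pc-is p)) e))
       (λ e → trans (Holds.pc-is p) (cong +_ e)))

program : ℕ → Program → Fm
program i []        = tt
program i (ins ∷ P) = and (at i ⊃ instr ins) (program (suc i) P)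

program-beyond : ∀ {c ν} i P → Prev c ν → Config.pc c < i → sat (program i P) ν
program-beyond i []        p lt = tt
program-beyond {ν = ν} i (ins ∷ P) p lt =
  ⊃-vacuous {at i} {instr ins} {ν} (λ h → ℕP.<-irrefl (to (at⇔ i p) h) lt)
  , program-beyond (suc i) P p (ℕP.m<n⇒m<1+n lt)

program-selects : ∀ {c ν ins} i P q → Prev c ν → Config.pc c ≡ i ℕ.+ q →
                  lookupI P q ≡ just ins → sat (program i P) ν ⇔ sat (instr ins) ν
program-selects {c} {ν} {ins} i (ins ∷ P) zero p e refl =
  mk⇔ (λ (h , _) → to (⊃-fires {at i} {ν = ν} (instr-qf ins) current) h)
      (λ s → from (⊃-fires {at i} {ν = ν} (instr-qf ins) current) s
           , program-beyond (suc i) P p (s≤s (ℕP.≤-reflexive pc≡i)))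
  where
  pc≡i : Config.pc c ≡ i
  pc≡i = trans e (ℕP.+-identityʳ i)
  current : sat (at i) ν
  current = from (at⇔ i p) pc≡i
program-selects {ν = ν} i (ins′ ∷ P) (suc q) p e l =
  ⇔-trans (mk⇔ proj₂ (λ s → ⊃-vacuous {at i} {instr ins′} {ν} skip , s))
          (program-selects (suc i) P q p (trans e (ℕP.+-suc i q)) l)
  where
  skip : ¬ sat (at i) ν
  skip h = ℕP.m≢1+m+n i (trans (sym (to (at⇔ i p) h)) (trans e (ℕP.+-suc i q)))

in-range : Program → Fm
in-range P = clause (gap (cst (+ length P)) (var prevPc) (+ 1))

in-range⇔ : ∀ {c ν} P → Prev c ν → sat (in-range P) ν ⇔ (Config.pc c < length P)
in-range⇔ {ν = ν} P p = gap-one-at {ν} (cst (+ length P)) (var prevPc) refl (Holds.pc-is p)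

stepF : Program → Fm
stepF P = and (in-range P) (program 0 P)

step-correct : ∀ {c ν} P → Prev c ν → sat (stepF P) ν ⇔ (isHalted P c ≡ false × Next (stepM P c) ν)
step-correct {c} {ν} P p = by-lookup _ refl
  where
  by-lookup : ∀ m → lookupI P (Config.pc c) ≡ m → sat (stepF P) ν ⇔ (isHalted P c ≡ false × Next (stepM P c) ν)
  by-lookup (just ins) eq =
    ⇔-trans (in-range⇔ P p) (mk⇔ (λ _ → running P c eq) (λ _ → lookup-in-range P _ eq))
    ×-⇔ ⇔-trans (program-selects 0 P _ p refl eq)
                (subst (λ d → sat (instr ins) ν ⇔ Next d ν) (sym (stepM-exec P c eq)) (instr-correct ins p))
  by-lookup nothing eq =
    mk⇔ (λ (lt , _) → ⊥-elim (in-range-lookup P _ (to (in-range⇔ P p) lt) eq))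
        (λ (h , _) → ⊥-elim (true≢false (trans (sym (halted P c eq)) h)))

reduction : Program → MCInstance
reduction P = mc copySys (encode (run P 0) (run P 1)) (EG (stepF P))

-- A non-halting run, paired with its shift, is a witnessing path.
nonhalting⇒EG : ∀ P → ¬ Halts P → ModelCheck (reduction P)
nonhalting⇒EG P never = path , (λ _ → fz) , (λ _ → refl)
                      , (λ i → from copy-step⇔ (refl , refl , refl))
                      , (λ i → from (step-correct P (holds refl refl refl))
                                    (¬-not (λ h → never (i , h)) , holds refl refl refl))
  where
  path : ℕ → Val 6
  path i = encode (run P i) (run P (suc i))

-- Along a witnessing path, state i stores the i-th configuration of the run
-- as its previous part; so that configuration is never halted.
EG⇒nonhalting : ∀ P → ModelCheck (reduction P) → ¬ Halts P
EG⇒nonhalting P (path , _ , start , steps , correct) (t , halts) =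
  true≢false (trans (sym halts) (proj₁ (to (step-correct P (tracks t)) (correct t))))
  where
  tracks : ∀ i → Prev (run P i) (path i)
  tracks zero    = holds (start prevPc) (start prevC₀) (start prevC₁)
  tracks (suc i) with to copy-step⇔ (steps i) | proj₂ (to (step-correct P (tracks i)) (correct i))
  ... | pc , c₀ , c₁ | holds pc′ c₀′ c₁′ = holds (trans pc pc′) (trans c₀ c₀′) (trans c₁ c₁′)

theorem1 : (Halts ⪯ ModelCheck) ⊎ ((λ P → ¬ Halts P) ⪯ ModelCheck)
theorem1 = inj₂ (reduction , λ P → mk⇔ (nonhalting⇒EG P) (EG⇒nonhalting P))
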